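{- Let $p\geq 17$ be a prime. There exists a covering system of the integers whose moduli are all odd and greater than $1$, in which exactly $p-5$ congruences have modulus $p$ and the congruences with moduli different from $p$ have pairwise distinct moduli. Further, this covering system has no congruence with modulus $p^2$.
   Context: A covering system is a finite collection of congruences $r_i\pmod{m_i}$ such that every integer satisfies at least one of them. -}

module Defs where

open import Data.Nat using (ℕ; _<_; _≡ᵇ_)
open import Data.Nat.Primality using (Prime)
open import Data.Integer as ℤ using (ℤ; +_; _-_)
open import Data.Integer.Divisibility using () renaming (_∣_ to _∣ℤ_)
open import Data.Bool using (not)
open import Data.List using (List; map; filter; length; filterᵇ)
open import Data.List.Relation.Unary.All using (All)
open import Data.List.Relation.Unary.Any using (Any)
open import Data.List.Relation.Unary.Unique.Propositional using (Unique)
open import Data.Product using (_×_; proj₁; proj₂; _,_)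
open import Relation.Binary.PropositionalEquality using (_≡_; _≢_)

-- A congruence  r (mod m)  is stored as the pair (r , m) of naturals,
-- with the residue normalised: 0 ≤ r < m.
Congruence : Set
Congruence = ℕ × ℕ

residue : Congruence → ℕ
residue = proj₁

modulus : Congruence → ℕ
modulus = proj₂

Satisfies : ℤ → Congruence → Set
Satisfies x c = (+ modulus c) ∣ℤ (x - + residue c)

record IsCoveringSystem (cs : List Congruence) : Set where
  field
    normalised : All (λ c → residue c < modulus c) cs
    distinct   : Unique cs
    covers     : (x : ℤ) → Any (Satisfies x) cs

moduli : List Congruence → List ℕ
moduli = map modulus

countModulus : ℕ → List Congruence → ℕ
countModulus m cs = length (filterᵇ (λ c → modulus c ≡ᵇ m) cs)

otherModuli : ℕ → List Congruence → List ℕ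
otherModuli m cs = filterᵇ (λ k → not (k ≡ᵇ m)) (moduli cs)

{-# OPTIONS --safe #-}
-- The residues 0, 6, 7, …, p − 1 modulo p are covered by the modulus p itself, and the classes 1, …, 5 by the other
-- moduli.  For a prime q write an integer not divisible by q^d as x ≡ s q^(e − 1) mod q^e with 1 ≤ e ≤ d and
-- 0 < s < q.  Prescribing digits s_q for the primes q in a set S, whatever the levels e_q, takes one congruence
-- modulo ∏ q^e_q for each tuple of levels, and these moduli are distinct for distinct S.  So it remains to cover the
-- product of the digit sets of 3, 5, 7, 11, 13, 19, 23 and of {1, …, 5} for p by boxes, at most one for each set S of
-- fixed coordinates other than ∅ and {p}; the table below is such a family, found by a computer search.  The integers
-- divisible by q^d for some q are covered by means of one further prime r = d: the moduli r q, r q^2, …, r q^r take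
-- the r residues modulo r.  Should p be one of 19, 23 and r = 29, then 17 replaces it, since a smaller prime has
-- fewer digits.
module Submission where

open import Defs
open import Data.Bool using (Bool; true; false; _∧_; _∨_; if_then_else_; not; T)
open import Data.Bool.ListAction using (any)
import Data.Bool.Properties as Bool
open import Data.Empty using (⊥-elim)
open import Data.Fin using (Fin; zero; suc)
open import Data.Integer as ℤ using (ℤ; +_; -_; _-_; ∣_∣)
open import Data.Integer.DivMod using (_%ℕ_; _/ℕ_; n%ℕd<d; a≡a%ℕn+[a/ℕn]*n)
open import Data.Integer.Divisibility.Signed as ℤ∣ using () renaming (_∣_ to _∣ₛ_)
import Data.Integer.Properties as ℤ
open import Data.Integer.Tactic.RingSolver using (solve-∀)
open import Data.List as List using (List; []; _∷_; _++_; applyUpTo; cartesianProductWith; filter; filterᵇ; length; upTo)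
open import Data.List.Membership.Propositional using (_∈_; lose)
open import Data.List.Membership.Propositional.Properties using (∈-++⁺ˡ; ∈-++⁺ʳ; ∈-applyUpTo⁺; ∈-cartesianProductWith⁺; ∈-filter⁺; ∈-map⁺; ∈-upTo⁺)
open import Data.List.Properties using (++-identityʳ; filter-++; filter-all; filter-none; length-applyUpTo; length-map; map-++; map-∘)
open import Data.List.Relation.Unary.All as ListAll using (All; []; _∷_)
import Data.List.Relation.Unary.All.Properties as ListAll
open import Data.List.Relation.Unary.AllPairs using ([]; _∷_)
open import Data.List.Relation.Unary.Any using (Any; here; there)
open import Data.List.Relation.Unary.Unique.Propositional using (Unique)
import Data.List.Relation.Unary.Unique.Propositional.Properties as Unique
open import Data.Nat hiding (∣_-_∣)
open import Data.Nat.Coprimality as Coprimality using (Coprime; coprime?; coprime-divisor; coprime-Bézout)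
open import Data.Nat.Divisibility using (_∣_; _∤_; divides; ∣-refl; ∣-trans; ∣1⇒≡1; m∣m*n; *-monoʳ-∣)
open import Data.Nat.GCD using (module Bézout)
open import Data.Nat.Primality using (Prime; prime?; prime[2]; prime⇒irreducible; prime⇒nonTrivial)
open import Data.Nat.Properties
open import Data.Product using (Σ; ∃; ∃₂; _×_; _,_; proj₁; proj₂)
open import Data.Sum using (_⊎_; inj₁; inj₂)
open import Data.Unit using (tt)
open import Data.Vec as Vec using (Vec; []; _∷_; lookup; replicate; sum; tail; zipWith)
open import Data.Vec.Properties using (≡-dec; ∷-injective; ∷-injectiveʳ)
open import Data.Vec.Relation.Binary.Pointwise.Inductive as Pointwise using (Pointwise; []; _∷_)
open import Data.Vec.Relation.Unary.All as VecAll using ([]; _∷_)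
open import Data.Vec.Relation.Unary.AllPairs using (AllPairs; []; _∷_; allPairs?)
open import Function using (_∘_)
open import Function.Bundles using (module Equivalence)
open import Relation.Binary.PropositionalEquality
open import Relation.Nullary using (¬_; Dec; yes; no; ¬?; contradiction; does)
open import Relation.Nullary.Decidable using (T?; True; from-yes; toWitness; _×-dec_)

private variable
  k m n : ℕ

-- Congruences between integers and the Chinese remainder theorem.

infix 4 _≈_mod_
-- A record, so that unification can recover `x` and `y`, which a bare divisibility of `x - y` would
-- hide.
record _≈_mod_ (x y : ℤ) (m : ℕ) : Set where
  constructor congruent
  field divides-difference : + m ∣ₛ x - y

open _≈_mod_

≈-sym : ∀ {x y} → x ≈ y mod m → y ≈ x mod m
≈-sym {m} {x} {y} (congruent h) = congruent (subst (+ m ∣ₛ_) (lemma x y) (ℤ∣.∣m⇒∣-m h))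
  where
  lemma : ∀ x y → - (x - y) ≡ y - x
  lemma = solve-∀

≈-trans : ∀ {x y z} → x ≈ y mod m → y ≈ z mod m → x ≈ z mod m
≈-trans {m} {x} {y} {z} (congruent h) (congruent h′) =
  congruent (subst (+ m ∣ₛ_) (lemma x y z) (ℤ∣.∣m∣n⇒∣m+n h h′))
  where
  lemma : ∀ x y z → (x - y) ℤ.+ (y - z) ≡ x - z
  lemma = solve-∀

≈-weaken : ∀ {x y} → m ∣ n → x ≈ y mod n → x ≈ y mod m
≈-weaken m∣n (congruent h) = congruent (ℤ∣.∣-trans (ℤ∣.∣ᵤ⇒∣ m∣n) h)

≈-% : ∀ x m .{{_ : NonZero m}} → x ≈ + (x %ℕ m) mod m
≈-% x m = congruent (ℤ∣.divides (x /ℕ m) (begin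
  x - + (x %ℕ m)                                      ≡⟨ cong (_- + (x %ℕ m)) (a≡a%ℕn+[a/ℕn]*n x m) ⟩
  (+ (x %ℕ m) ℤ.+ (x /ℕ m) ℤ.* + m) - + (x %ℕ m)      ≡⟨ lemma (+ (x %ℕ m)) ((x /ℕ m) ℤ.* + m) ⟩
  (x /ℕ m) ℤ.* + m                                    ∎))
  where
  open ≡-Reasoning
  lemma : ∀ a b → (a ℤ.+ b) - a ≡ b
  lemma = solve-∀

≈-mod-1 : ∀ x y → x ≈ y mod 1
≈-mod-1 x y = congruent (ℤ∣.divides (x - y) (sym (ℤ.*-identityʳ _)))

coprime-* : Coprime k m → Coprime k n → Coprime k (m * n)
coprime-* c c′ (d∣k , d∣mn) =
  c′ (d∣k , coprime-divisor (λ (e∣d , e∣m) → c (∣-trans e∣d d∣k , e∣m)) d∣mn)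

coprime-^ : ∀ e → Coprime k m → Coprime k (m ^ e)
coprime-^ zero    c (_ , d∣1) = ∣1⇒≡1 d∣1
coprime-^ (suc e) c = coprime-* c (coprime-^ e c)

-- If the difference is `m * q` in absolute value, then `n` divides `m * q` and is coprime to `m`,
-- hence divides `q`.
≈-* : Coprime m n → ∀ {x y} → x ≈ y mod m → x ≈ y mod n → x ≈ y mod (m * n)
≈-* {m} {n} c {x} {y} (congruent m∣z) (congruent n∣z) with ℤ∣.∣⇒∣ᵤ m∣z
... | divides q eq = congruent (ℤ∣.∣ᵤ⇒∣ (subst (m * n ∣_) (sym eq′) (*-monoʳ-∣ m n∣q)))
  where
  eq′ : ∣ x - y ∣ ≡ m * q
  eq′ = trans eq (*-comm q m)
  n∣q : n ∣ q
  n∣q = coprime-divisor (Coprimality.sym c) (subst (n ∣_) eq′ (ℤ∣.∣⇒∣ᵤ n∣z))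

coprime⇒inverse : Coprime m n → ∃ λ u → u ℤ.* + m ≈ + 1 mod n
coprime⇒inverse {m} {n} c with coprime-Bézout c
... | Bézout.+- x y eq = + x , congruent (ℤ∣.divides (+ y) (begin
    + x ℤ.* + m - + 1               ≡⟨ cong (_- + 1) (sym (ℤ.pos-* x m)) ⟩
    + (x * m) - + 1                 ≡⟨ cong (λ t → + t - + 1) (sym eq) ⟩
    + (1 + y * n) - + 1             ≡⟨ cong (_- + 1) (ℤ.pos-+ 1 (y * n)) ⟩
    (+ 1 ℤ.+ + (y * n)) - + 1       ≡⟨ lemma (+ (y * n)) ⟩
    + (y * n)                       ≡⟨ ℤ.pos-* y n ⟩
    + y ℤ.* + n                     ∎))
  where
  open ≡-Reasoning
  lemma : ∀ a → (+ 1 ℤ.+ a) - + 1 ≡ a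
  lemma = solve-∀
-- In this sign pattern `1 + x * m ≡ y * n`, so the inverse is `- x`.
... | Bézout.-+ x y eq = - (+ x) , congruent (ℤ∣.divides (- (+ y)) (begin
    - (+ x) ℤ.* + m - + 1           ≡⟨ lemma (+ x) (+ m) ⟩
    - (+ 1 ℤ.+ + x ℤ.* + m)         ≡⟨ cong (λ t → - (+ 1 ℤ.+ t)) (sym (ℤ.pos-* x m)) ⟩
    - (+ 1 ℤ.+ + (x * m))           ≡⟨ cong -_ (sym (ℤ.pos-+ 1 (x * m))) ⟩
    - (+ (1 + x * m))               ≡⟨ cong (λ t → - (+ t)) eq ⟩
    - (+ (y * n))                   ≡⟨ cong -_ (ℤ.pos-* y n) ⟩
    - (+ y ℤ.* + n)                 ≡⟨ ℤ.neg-distribˡ-* (+ y) (+ n) ⟩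
    - (+ y) ℤ.* + n                 ∎))
  where
  open ≡-Reasoning
  lemma : ∀ a b → - a ℤ.* b - + 1 ≡ - (+ 1 ℤ.+ a ℤ.* b)
  lemma = solve-∀

-- With `u` an inverse of `m` modulo `n`, the integer `a + (b - a) u m` has both residues; `c` is
-- its remainder modulo `m * n`.
crt : .{{_ : NonZero (m * n)}} → Coprime m n → ∀ a b →
      ∃ λ c → c < m * n × (∀ {x} → x ≈ + a mod m → x ≈ + b mod n → x ≈ + c mod (m * n))
crt {m} {n} cop a b with u , congruent um≈1 ← coprime⇒inverse cop
  = s %ℕ (m * n) , n%ℕd<d s (m * n) , λ x≈a x≈b →
      ≈-trans (≈-* cop (≈-trans x≈a (≈-sym s≈a)) (≈-trans x≈b (≈-sym s≈b))) (≈-% s (m * n))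
  where
  s = + a ℤ.+ (+ b - + a) ℤ.* (u ℤ.* + m)
  s≈a : s ≈ + a mod m
  s≈a = congruent (ℤ∣.divides ((+ b - + a) ℤ.* u) (lemma (+ a) (+ b) u (+ m)))
    where
    lemma : ∀ a b u m → (a ℤ.+ (b - a) ℤ.* (u ℤ.* m)) - a ≡ ((b - a) ℤ.* u) ℤ.* m
    lemma = solve-∀
  s≈b : s ≈ + b mod n
  s≈b = congruent (subst (+ n ∣ₛ_) (lemma (+ a) (+ b) (u ℤ.* + m)) (ℤ∣.∣n⇒∣m*n (+ b - + a) um≈1))
    where
    lemma : ∀ a b v → (b - a) ℤ.* (v - + 1) ≡ (a ℤ.+ (b - a) ℤ.* v) - b
    lemma = solve-∀

-- Moduli as products of powers of pairwise coprime bases, indexed by exponent vectors.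

prodPow : Vec ℕ n → Vec ℕ n → ℕ
prodPow []       []       = 1
prodPow (q ∷ qs) (e ∷ es) = q ^ e * prodPow qs es

prodPow≢0 : {qs : Vec ℕ n} → VecAll.All (1 <_) qs → ∀ es → NonZero (prodPow qs es)
prodPow≢0 [] [] = _
prodPow≢0 (q>1 ∷ qs>1) (e ∷ es) =
  m*n≢0 _ _ {{m^n≢0 _ e {{>-nonZero (<⇒≤ q>1)}}}} {{prodPow≢0 qs>1 es}}

coprime-prodPow : {qs : Vec ℕ n} → VecAll.All (Coprime k) qs → ∀ es → Coprime k (prodPow qs es)
coprime-prodPow []       []       (_ , d∣1) = ∣1⇒≡1 d∣1
coprime-prodPow (c ∷ cs) (e ∷ es) = coprime-* (coprime-^ e c) (coprime-prodPow cs es)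

prodPow-zeros : (qs : Vec ℕ n) → prodPow qs (replicate n 0) ≡ 1
prodPow-zeros []       = refl
prodPow-zeros (q ∷ qs) = trans (*-identityˡ _) (prodPow-zeros qs)

-- Cancel factors `q` from both sides until one exponent is 0; if the other were still positive, `q`
-- would divide a cofactor coprime to it.
^*-injective : ∀ {q M N} → 1 < q → Coprime q M → Coprime q N →
               ∀ a b → q ^ a * M ≡ q ^ b * N → a ≡ b × M ≡ N
^*-injective {q} {M} {N} q>1 cM cN zero zero eq =
  refl , trans (sym (*-identityˡ M)) (trans eq (*-identityˡ N))
^*-injective {q} {M} {N} q>1 cM cN zero (suc b) eq =
  ⊥-elim (<⇒≢ q>1 (sym (cM (∣-refl , subst (q ∣_) (sym eq′) (m∣m*n (q ^ b * N))))))
  where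
  eq′ : M ≡ q * (q ^ b * N)
  eq′ = trans (sym (*-identityˡ M)) (trans eq (*-assoc q (q ^ b) N))
^*-injective {q} {M} {N} q>1 cM cN (suc a) zero eq
  with b≡a , N≡M ← ^*-injective q>1 cN cM zero (suc a) (sym eq) = sym b≡a , sym N≡M
^*-injective {q} {M} {N} q>1 cM cN (suc a) (suc b) eq
  with a≡b , M≡N ← ^*-injective q>1 cM cN a b
         (*-cancelˡ-≡ _ _ q {{>-nonZero (<⇒≤ q>1)}}
           (trans (sym (*-assoc q (q ^ a) M)) (trans eq (*-assoc q (q ^ b) N))))
  = cong suc a≡b , M≡N

-- Unique factorisation, peeled off one base at a time. Distinctness of the composite moduli, and
-- their difference from powers of `p`, both rest on it.
prodPow-injective : {qs : Vec ℕ n} → VecAll.All (1 <_) qs → AllPairs Coprime qs →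
                    ∀ {es fs} → prodPow qs es ≡ prodPow qs fs → es ≡ fs
prodPow-injective [] [] {[]} {[]} _ = refl
prodPow-injective (q>1 ∷ qs>1) (c ∷ cs) {e ∷ es} {f ∷ fs} eq
  with e≡f , eq′ ← ^*-injective q>1 (coprime-prodPow c es) (coprime-prodPow c fs) e f eq
  = cong₂ _∷_ e≡f (prodPow-injective qs>1 cs eq′)

data Solves (x : ℤ) : (qs es as : Vec ℕ n) → Set where
  []  : Solves x [] [] []
  _∷_ : ∀ {q e a} {qs es as : Vec ℕ n} →
        x ≈ + a mod (q ^ e) → Solves x qs es as → Solves x (q ∷ qs) (e ∷ es) (a ∷ as)

crt-prodPow : {qs : Vec ℕ n} → VecAll.All (1 <_) qs → AllPairs Coprime qs → ∀ es as →
              ∃ λ c → c < prodPow qs es × (∀ {x} → Solves x qs es as → x ≈ + c mod prodPow qs es)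
crt-prodPow [] [] [] [] = 0 , s≤s z≤n , λ _ → ≈-mod-1 _ _
crt-prodPow {qs = q ∷ qs} qs>1@(_ ∷ qs>1′) (c ∷ cs) (e ∷ es) (a ∷ as) =
  let b , _  , solve  = crt-prodPow qs>1′ cs es as
      d , d< , solve′ = crt {{prodPow≢0 qs>1 (e ∷ es)}}
        (Coprimality.sym (coprime-^ e (Coprimality.sym (coprime-prodPow c es)))) a b
  in d , d< , λ { (h ∷ hs) → solve′ h (solve hs) }

boundedVecs : ∀ n → ℕ → List (Vec ℕ n)
boundedVecs zero    d = [] ∷ []
boundedVecs (suc n) d = cartesianProductWith _∷_ (upTo (suc d)) (boundedVecs n d)

boundedVecs-unique : ∀ n d → Unique (boundedVecs n d)
boundedVecs-unique zero    d = [] ∷ []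
boundedVecs-unique (suc n) d =
  Unique.cartesianProductWith⁺ _∷_ ∷-injective (Unique.upTo⁺ (suc d)) (boundedVecs-unique n d)

∈-boundedVecs : ∀ {d} {es : Vec ℕ n} → VecAll.All (_≤ d) es → es ∈ boundedVecs n d
∈-boundedVecs []           = here refl
∈-boundedVecs (e≤d ∷ es≤d) = ∈-cartesianProductWith⁺ _∷_ (∈-upTo⁺ (s≤s e≤d)) (∈-boundedVecs es≤d)

-- Lowest nonzero digits in several bases.

-- Together with `s < q`, which is recorded separately, this says that `s` is the lowest nonzero
-- base-`q` digit of `x`, in position `e - 1`.
data Digit (x : ℤ) (d q s e : ℕ) : Set where
  digit : 0 < s → 0 < e → e ≤ d → x ≈ + (s * q ^ (e ∸ 1)) mod (q ^ e) → Digit x d q s e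

-- Writing `x = y q^d`, the digit in position `d` is `y` modulo `q`; it may be 0.
nextDigit : ∀ {x} q .{{_ : NonZero q}} d → x ≈ + 0 mod (q ^ d) →
            ∃ λ s → s < q × x ≈ + (s * q ^ d) mod (q ^ suc d)
nextDigit {x} q d (congruent (ℤ∣.divides y x-0≡y*q^d)) =
  s , n%ℕd<d y q , congruent (ℤ∣.divides t (begin
    x - + (s * q ^ d)                                 ≡⟨ cong (λ z → x - z) (ℤ.pos-* s (q ^ d)) ⟩
    x - + s ℤ.* Q                                     ≡⟨ lemma₁ x (+ s ℤ.* Q) ⟩
    (x - + 0) - + s ℤ.* Q                             ≡⟨ cong (_- + s ℤ.* Q) x-0≡y*q^d ⟩
    y ℤ.* Q - + s ℤ.* Q                               ≡⟨ cong (λ z → z ℤ.* Q - + s ℤ.* Q) (a≡a%ℕn+[a/ℕn]*n y q) ⟩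
    (+ s ℤ.+ t ℤ.* + q) ℤ.* Q - + s ℤ.* Q             ≡⟨ lemma₂ (+ s) t (+ q) Q ⟩
    t ℤ.* (+ q ℤ.* Q)                                 ≡⟨ cong (t ℤ.*_) (sym (ℤ.pos-* q (q ^ d))) ⟩
    t ℤ.* + (q ^ suc d)                               ∎))
  where
  open ≡-Reasoning
  s = y %ℕ q
  t = y /ℕ q
  Q = + (q ^ d)
  lemma₁ : ∀ x a → x - a ≡ (x - + 0) - a
  lemma₁ = solve-∀
  lemma₂ : ∀ s t q Q → (s ℤ.+ t ℤ.* q) ℤ.* Q - s ℤ.* Q ≡ t ℤ.* (q ℤ.* Q)
  lemma₂ = solve-∀

lastDigit : ∀ x q .{{_ : NonZero q}} d →
            x ≈ + 0 mod (q ^ d) ⊎ ∃₂ λ s e → s < q × Digit x d q s e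
lastDigit x q zero = inj₁ (≈-mod-1 _ _)
lastDigit x q (suc d) with lastDigit x q d
... | inj₂ (s , e , s<q , digit 0<s 0<e e≤d h) = inj₂ (s , e , s<q , digit 0<s 0<e (m≤n⇒m≤1+n e≤d) h)
... | inj₁ h with nextDigit q d h
-- A zero digit means divisibility by one more power of `q`; a nonzero one is the digit sought.
...   | zero  , _   , h′ = inj₁ h′
...   | suc s , s<q , h′ = inj₂ (suc s , suc d , s<q , digit (s≤s z≤n) (s≤s z≤n) ≤-refl h′)

data Digits (x : ℤ) (d : ℕ) : (qs ss es : Vec ℕ n) → Set where
  []  : Digits x d [] [] []
  _∷_ : ∀ {q s e} {qs ss es : Vec ℕ n} →
        Digit x d q s e → Digits x d qs ss es → Digits x d (q ∷ qs) (s ∷ ss) (e ∷ es)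

-- This dichotomy splits the covering: the first alternative is left to the prime `r`, the second to
-- the table of boxes.
lastDigits : ∀ x d {qs : Vec ℕ n} → VecAll.All NonZero qs →
             (∃ λ i → x ≈ + 0 mod (lookup qs i ^ d)) ⊎
             ∃₂ λ ss es → Pointwise _<_ ss qs × Digits x d qs ss es
lastDigits x d [] = inj₂ ([] , [] , [] , [])
lastDigits x d {q ∷ _} (q≢0 ∷ qs≢0) with lastDigit x q {{q≢0}} d | lastDigits x d qs≢0
... | inj₁ h | _ = inj₁ (zero , h)
... | inj₂ _ | inj₁ (i , h) = inj₁ (suc i , h)
... | inj₂ (s , e , s<q , D) | inj₂ (ss , es , ss<qs , Ds) =
  inj₂ (s ∷ ss , e ∷ es , s<q ∷ ss<qs , D ∷ Ds)

-- Exponent vectors of a single prime power.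

unit : Fin n → ℕ → Vec ℕ n
unit zero    k = k ∷ replicate _ 0
unit (suc i) k = 0 ∷ unit i k

sum-zeros : ∀ n → sum (replicate n 0) ≡ 0
sum-zeros zero    = refl
sum-zeros (suc n) = sum-zeros n

-- Lets the exponent be read off without knowing which prime carries it.
sum-unit : ∀ (i : Fin n) k → sum (unit i k) ≡ k
sum-unit {suc n} zero k = trans (cong (λ z → k + z) (sum-zeros n)) (+-identityʳ k)
sum-unit (suc i)      k = sum-unit i k

zeros-bounded : ∀ {d} n → VecAll.All (_≤ d) (replicate n 0)
zeros-bounded zero    = []
zeros-bounded (suc n) = z≤n ∷ zeros-bounded n

unit-bounded : ∀ {d} (i : Fin n) {k} → k ≤ d → VecAll.All (_≤ d) (unit i k)
unit-bounded zero    k≤d = k≤d ∷ zeros-bounded _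
unit-bounded (suc i) k≤d = z≤n ∷ unit-bounded i k≤d

solves-zeros : ∀ {x} (qs as : Vec ℕ n) → Solves x qs (replicate n 0) as
solves-zeros []       []       = []
solves-zeros (q ∷ qs) (a ∷ as) = ≈-mod-1 _ _ ∷ solves-zeros qs as

solves-unit : ∀ {x} (qs : Vec ℕ n) i {k} → x ≈ + 0 mod (lookup qs i ^ k) →
              Solves x qs (unit i k) (replicate n 0)
solves-unit (q ∷ qs) zero    h = h ∷ solves-zeros qs _
solves-unit (q ∷ qs) (suc i) h = ≈-mod-1 _ _ ∷ solves-unit qs i h

-- Boxes of digits and a Boolean test that they cover a product.

-- A row describes a box: a zero entry leaves the coordinate free, and a nonzero entry fixes it.
data Matches : (row ss : Vec ℕ n) → Set where
  []   : Matches [] []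
  free : ∀ {s} {row ss : Vec ℕ n} → Matches row ss → Matches (0 ∷ row) (s ∷ ss)
  same : ∀ {s} {row ss : Vec ℕ n} → Matches row ss → Matches (s ∷ row) (s ∷ ss)

allZero : Vec ℕ n → Bool
allZero []       = true
allZero (t ∷ ts) = (t ≡ᵇ 0) ∧ allZero ts

restrict : ℕ → List (Vec ℕ (suc n)) → List (Vec ℕ n)
restrict s []                = []
restrict s ((t ∷ ts) ∷ rows) = if (t ≡ᵇ 0) ∨ (t ≡ᵇ s) then ts ∷ restrict s rows else restrict s rows

allPositiveUpTo : ℕ → (ℕ → Bool) → Bool
allPositiveUpTo zero    f = true
allPositiveUpTo (suc b) f = f (suc b) ∧ allPositiveUpTo b f

-- A tree search over the digits, one coordinate at a time. A surviving box that is free in all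
-- remaining coordinates settles the whole subtree; this pruning avoids visiting each of the
-- 11404800 points of the product given by `bounds`.
covers : Vec ℕ n → List (Vec ℕ n) → Bool
covers []       rows = any allZero rows
covers (b ∷ bs) rows = any allZero rows ∨ allPositiveUpTo b (λ s → covers bs (restrict s rows))

allZero-matches : (row ss : Vec ℕ n) → T (allZero row) → Matches row ss
allZero-matches []            []       _ = []
allZero-matches (zero ∷ row) (s ∷ ss) h = free (allZero-matches row ss h)

any-allZero-matches : (rows : List (Vec ℕ n)) (ss : Vec ℕ n) → T (any allZero rows) →
                      ∃ λ row → row ∈ rows × Matches row ss
any-allZero-matches (row ∷ rows) ss h with Equivalence.to (Bool.T-∨ {allZero row}) h
... | inj₁ h₁ = row , here refl , allZero-matches row ss h₁
... | inj₂ h₂ with row′ , row′∈ , m ← any-allZero-matches rows ss h₂ = row′ , there row′∈ , m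

restrict-matches : ∀ s (rows : List (Vec ℕ (suc n))) {ts} {ss : Vec ℕ n} → ts ∈ restrict s rows →
                   Matches ts ss → ∃ λ row → row ∈ rows × Matches row (s ∷ ss)
restrict-matches s ((t ∷ ts) ∷ rows) ts∈ m with t ≡ᵇ 0 in t≡0 | t ≡ᵇ s in t≡s
restrict-matches s ((t ∷ ts) ∷ rows) ts∈ m | false | false
  with row , row∈ , m′ ← restrict-matches s rows ts∈ m = row , there row∈ , m′
restrict-matches s ((t ∷ ts) ∷ rows) (there ts∈) m | true | _
  with row , row∈ , m′ ← restrict-matches s rows ts∈ m = row , there row∈ , m′
restrict-matches s ((t ∷ ts) ∷ rows) (there ts∈) m | false | true
  with row , row∈ , m′ ← restrict-matches s rows ts∈ m = row , there row∈ , m′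
restrict-matches s ((t ∷ ts) ∷ rows) (here refl) m | true | _
  with refl ← ≡ᵇ⇒≡ t 0 (subst T (sym t≡0) tt) = t ∷ ts , here refl , free m
restrict-matches s ((t ∷ ts) ∷ rows) (here refl) m | false | true
  with refl ← ≡ᵇ⇒≡ t s (subst T (sym t≡s) tt) = t ∷ ts , here refl , same m

allPositiveUpTo-sound : ∀ b f → T (allPositiveUpTo b f) → ∀ {s} → 0 < s → s ≤ b → T (f s)
allPositiveUpTo-sound zero    f _ 0<s z≤n = contradiction 0<s λ ()
allPositiveUpTo-sound (suc b) f h {s} 0<s s≤b with h₁ , h₂ ← Equivalence.to (Bool.T-∧ {f (suc b)}) h | s ≟ suc b
... | yes refl = h₁
... | no s≢    = allPositiveUpTo-sound b f h₂ 0<s (s≤s⁻¹ (≤∧≢⇒< s≤b s≢))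

-- Follow the branch of the search selected by `ss` to the node where it was pruned, then lift the
-- box found there back through the restrictions.
covers-sound : ∀ {bs : Vec ℕ n} {rows ss} → T (covers bs rows) → VecAll.All (0 <_) ss → Pointwise _≤_ ss bs →
               ∃ λ row → row ∈ rows × Matches row ss
covers-sound {bs = []} {rows} {[]} h [] [] = any-allZero-matches rows [] h
covers-sound {bs = b ∷ bs} {rows} {s ∷ ss} h (0<s ∷ 0<ss) (s≤b ∷ ss≤bs)
  with Equivalence.to (Bool.T-∨ {any allZero rows}) h
... | inj₁ h₁ = any-allZero-matches rows (s ∷ ss) h₁
... | inj₂ h₂
  with ts , ts∈ , m ← covers-sound {rows = restrict s rows} (allPositiveUpTo-sound b _ h₂ 0<s s≤b) 0<ss ss≤bs
  = restrict-matches s rows ts∈ m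

-- From a box and the levels of an integer to an exponent vector.

-- The set `S` of primes involved, as a bit vector; it is taken of rows and of exponent vectors
-- alike.
support : Vec ℕ n → Vec Bool n
support = Vec.map (λ e → not (e ≡ᵇ 0))

truncate : (row es : Vec ℕ n) → Vec ℕ n
truncate = zipWith (λ t e → if t ≡ᵇ 0 then 0 else e)

-- At `e = 0` the truncated subtraction is harmless, since the modulus is then 1.
digitResidues : (qs ss es : Vec ℕ n) → Vec ℕ n
digitResidues []       []       []       = []
digitResidues (q ∷ qs) (s ∷ ss) (e ∷ es) = s * q ^ (e ∸ 1) ∷ digitResidues qs ss es

module _ {x : ℤ} {d : ℕ} where

  truncate-bounded : ∀ {qs row ss es : Vec ℕ n} → Digits x d qs ss es → Matches row ss →
                     VecAll.All (_≤ d) (truncate row es)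
  truncate-bounded []       []       = []
  truncate-bounded (D ∷ Ds) (free m) = z≤n ∷ truncate-bounded Ds m
  -- Matching `0 < s` exposes `s` as a successor, so that the zero test inside `truncate` reduces.
  truncate-bounded (digit (s≤s _) _ e≤d _ ∷ Ds) (same m) = e≤d ∷ truncate-bounded Ds m

  -- Digits and levels are positive, so no fixed prime drops out of the modulus, and the support of
  -- the row survives in the exponent vector.
  support-truncate : ∀ {qs row ss es : Vec ℕ n} → Digits x d qs ss es → Matches row ss →
                     support (truncate row es) ≡ support row
  support-truncate []       []       = refl
  support-truncate (D ∷ Ds) (free m) = cong (false ∷_) (support-truncate Ds m)
  support-truncate (digit (s≤s _) (s≤s _) _ _ ∷ Ds) (same m) =
    cong (true ∷_) (support-truncate Ds m)

  solves-truncate : ∀ {qs row ss es : Vec ℕ n} → Digits x d qs ss es → Matches row ss →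
                    Solves x qs (truncate row es) (digitResidues qs row (truncate row es))
  solves-truncate []       []       = []
  solves-truncate (D ∷ Ds) (free m) = ≈-mod-1 _ _ ∷ solves-truncate Ds m
  solves-truncate (digit (s≤s _) _ _ h ∷ Ds) (same m) = h ∷ solves-truncate Ds m

-- A support absent from the list defaults to the zero row, so its moduli receive the class 0.
lookupRow : List (Vec ℕ n) → Vec Bool n → Vec ℕ n
lookupRow []           bs = replicate _ 0
lookupRow (row ∷ rows) bs = if does (≡-dec Bool._≟_ (support row) bs) then row else lookupRow rows bs

-- The family of boxes and its verification by computation.

box : (p₁ q₁ q₂ q₃ q₄ q₅ q₆ q₇ : ℕ) → Vec ℕ 8
box p₁ q₁ q₂ q₃ q₄ q₅ q₆ q₇ = p₁ ∷ q₁ ∷ q₂ ∷ q₃ ∷ q₄ ∷ q₅ ∷ q₆ ∷ q₇ ∷ []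

-- The coordinates belong to p, 3, 5, 7, 11, 13, 19, 23 in this order.
bounds : Vec ℕ 8
bounds = box 5 2 4 6 10 12 18 22

-- Rows are ordered by the number of fixed coordinates. Of the 254 supports other than the empty one
-- and that of `p` alone, 241 occur.
table : List (Vec ℕ 8)
table =
  box  0  1  0  0  0  0  0  0 ∷
  box  0  0  1  0  0  0  0  0 ∷
  box  0  0  0  1  0  0  0  0 ∷
  box  0  0  0  0  1  0  0  0 ∷
  box  0  0  0  0  0  1  0  0 ∷
  box  0  0  0  0  0  0  1  0 ∷
  box  0  0  0  0  0  0  0  1 ∷
  box  1  2  0  0  0  0  0  0 ∷
  box  3  0  3  0  0  0  0  0 ∷
  box  5  0  0  3  0  0  0  0 ∷
  box  2  0  0  0  8  0  0  0 ∷
  box  2  0  0  0  0 11  0  0 ∷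
  box  2  0  0  0  0  0  5  0 ∷
  box  2  0  0  0  0  0  0 21 ∷
  box  0  2  2  0  0  0  0  0 ∷
  box  0  2  0  2  0  0  0  0 ∷
  box  0  2  0  0  2  0  0  0 ∷
  box  0  2  0  0  0  2  0  0 ∷
  box  0  2  0  0  0  0  2  0 ∷
  box  0  2  0  0  0  0  0  2 ∷
  box  0  0  4  6  0  0  0  0 ∷
  box  0  0  4  0  4  0  0  0 ∷
  box  0  0  4  0  0  6  0  0 ∷
  box  0  0  3  0  0  0  3  0 ∷
  box  0  0  3  0  0  0  0 18 ∷
  box  0  0  0  5  9  0  0  0 ∷
  box  0  0  0  3  0  4  0  0 ∷
  box  0  0  0  3  0  0  7  0 ∷
  box  0  0  0  4  0  0  0  3 ∷
  box  0  0  0  0  6  7  0  0 ∷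
  box  0  0  0  0  4  0  9  0 ∷
  box  0  0  0  0  9  0  0 22 ∷
  box  0  0  0  0  0  9 17  0 ∷
  box  0  0  0  0  0  4  0 16 ∷
  box  0  0  0  0  0  0  8 14 ∷
  box  4  2  3  0  0  0  0  0 ∷
  box  5  2  0  5  0  0  0  0 ∷
  box  2  2  0  0  5  0  0  0 ∷
  box  2  2  0  0  0  8  0  0 ∷
  box  2  2  0  0  0  0  8  0 ∷
  box  2  2  0  0  0  0  0  8 ∷
  box  5  0  3  4  0  0  0  0 ∷
  box  2  0  3  0  3  0  0  0 ∷
  box  2  0  3  0  0  5  0  0 ∷
  box  2  0  3  0  0  0 12  0 ∷
  box  2  0  3  0  0  0  0 11 ∷
  box  3  0  0  5  5  0  0  0 ∷
  box  4  0  0  3  0 11  0  0 ∷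
  box  2  0  0  6  0  0 11  0 ∷
  box  2  0  0  6  0  0  0 14 ∷
  box  2  0  0  0  6  3  0  0 ∷
  box  2  0  0  0  4  0 18  0 ∷
  box  2  0  0  0  9  0  0 17 ∷
  box  2  0  0  0  0  4 10  0 ∷
  box  2  0  0  0  0  4  0  5 ∷
  box  2  0  0  0  0  0 18 13 ∷
  box  0  2  4  4  0  0  0  0 ∷
  box  0  2  4  0 10  0  0  0 ∷
  box  0  2  4  0  0 12  0  0 ∷
  box  0  2  3  0  0  0 15  0 ∷
  box  0  2  3  0  0  0  0 20 ∷
  box  0  2  0  5  7  0  0  0 ∷
  box  0  2  0  3  0 10  0  0 ∷
  box  0  2  0  3  0  0 11  0 ∷
  box  0  2  0  6  0  0  0  7 ∷
  box  0  2  0  0  7  7  0  0 ∷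
  box  0  2  0  0  4  0  6  0 ∷
  box  0  2  0  0  9  0  0 16 ∷
  box  0  2  0  0  0  9 10  0 ∷
  box  0  2  0  0  0  9  0 11 ∷
  box  0  2  0  0  0  0  8  3 ∷
  box  0  0  4  5  3  0  0  0 ∷
  box  0  0  4  3  0  3  0  0 ∷
  box  0  0  4  3  0  0 14  0 ∷
  box  0  0  3  4  0  0  0  7 ∷
  box  0  0  3  0  7 12  0  0 ∷
  box  0  0  3  0  4  0 16  0 ∷
  box  0  0  3  0  9  0  0  4 ∷
  box  0  0  4  0  0  9  3  0 ∷
  box  0  0  3  0  0  4  0  4 ∷
  box  0  0  4  0  0  0  8  7 ∷
  box  0  0  0  3  5  7  0  0 ∷
  box  0  0  0  6  9  0 17  0 ∷
  box  0  0  0  4  9  0  0 15 ∷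
  box  0  0  0  3  0  9  4  0 ∷
  box  0  0  0  3  0  9  0 21 ∷
  box  0  0  0  3  0  0  8 18 ∷
  box  0  0  0  0  7  9 13  0 ∷
  box  0  0  0  0  6  4  0  6 ∷
  box  0  0  0  0  9  0 10 10 ∷
  box  0  0  0  0  0  9  8 17 ∷
  box  5  2  3  6  0  0  0  0 ∷
  box  2  2  3  0 10  0  0  0 ∷
  box  2  2  3  0  0  6  0  0 ∷
  box  2  2  3  0  0  0 14  0 ∷
  box  2  2  3  0  0  0  0 12 ∷
  box  4  2  0  5  6  0  0  0 ∷
  box  3  2  0  3  0  8  0  0 ∷
  box  2  2  0  4  0  0  7  0 ∷
  box  2  2  0  6  0  0  0 15 ∷
  box  2  2  0  0  6 10  0  0 ∷
  box  2  2  0  0  9  0 18  0 ∷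
  box  2  2  0  0  9  0  0  6 ∷
  box  2  2  0  0  0  9  6  0 ∷
  box  2  2  0  0  0  9  0  6 ∷
  box  2  2  0  0  0  0 18 10 ∷
  box  3  0  4  5  6  0  0  0 ∷
  box  4  0  4  3  0  8  0  0 ∷
  box  2  0  3  6  0  0  7  0 ∷
  box  2  0  3  6  0  0  0  3 ∷
  box  2  0  3  0  7 10  0  0 ∷
  box  2  0  3  0  4  0 13  0 ∷
  box  2  0  3  0  9  0  0 13 ∷
  box  2  0  3  0  0  9  9  0 ∷
  box  2  0  3  0  0  4  0 13 ∷
  box  2  0  3  0  0  0  9  5 ∷
  box  2  0  0  5  6  4  0  0 ∷
  box  2  0  0  4  9  0  6  0 ∷
  box  2  0  0  3  9  0  0 10 ∷
  box  3  0  0  3  0  9  5  0 ∷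
  box  2  0  0  4  0  4  0 19 ∷
  box  4  0  0  3  0  0  8  5 ∷
  box  2  0  0  0  4 12 10  0 ∷
  box  2  0  0  0  9  3  0  7 ∷
  box  2  0  0  0  9  0  9 10 ∷
  box  2  0  0  0  0  9  4  9 ∷
  box  0  2  4  5  8  0  0  0 ∷
  box  0  2  4  3  0  5  0  0 ∷
  box  0  2  4  3  0  0 16  0 ∷
  box  0  2  3  4  0  0  0 14 ∷
  box  0  2  3  0  6 12  0  0 ∷
  box  0  2  3  0  4  0  4  0 ∷
  box  0  2  4  0  0  9 15  0 ∷
  box  0  2  4  0  0  9  0  4 ∷
  box  0  2  4  0  0  0  8 15 ∷
  box  0  2  0  3  9  7  0  0 ∷
  box  0  2  0  6  9  0 13  0 ∷
  box  0  2  0  3  9  0  0 19 ∷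
  box  0  2  0  3  0  9 18  0 ∷
  box  0  2  0  3  0  9  0 13 ∷
  box  0  2  0  4  0  0 18  9 ∷
  box  0  2  0  0  6  9 13  0 ∷
  box  0  2  0  0  6  4  0 10 ∷
  box  0  2  0  0  9  0 16  5 ∷
  box  0  2  0  0  0  9  8 12 ∷
  box  0  0  4  3  8  7  0  0 ∷
  box  0  0  3  4  9  0  4  0 ∷
  box  0  0  4  3  5  0  0 12 ∷
  box  0  0  4  3  0  9 12  0 ∷
  box  0  0  3  6  0  4  0 17 ∷
  box  0  0  4  3  0  0 13 20 ∷
  box  0  0  3  0  7  4  0 15 ∷
  box  0  0  3  0  9  0 16 10 ∷
  box  0  0  4  0  0  9  8  8 ∷
  box  0  0  0  3  8  9 13  0 ∷
  box  0  0  0  3  9  3  0 14 ∷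
  box  0  0  0  6  9  0  6  5 ∷
  box  0  0  0  3  0  9  8 19 ∷
  box  0  0  0  0  5  9 13 10 ∷
  box  4  2  4  5  5  0  0  0 ∷
  box  3  2  4  3  0 11  0  0 ∷
  box  2  2  3  4  0  0 11  0 ∷
  box  2  2  3  6  0  0  0 19 ∷
  box  2  2  3  0  7  3  0  0 ∷
  box  2  2  3  0  4  0 17  0 ∷
  box  2  2  3  0  9  0  0  9 ∷
  box  2  2  3  0  0  9 16  0 ∷
  box  2  2  3  0  0  4  0 22 ∷
  box  2  2  3  0  0  0 18 16 ∷
  box  2  2  0  5  6  9  0  0 ∷
  box  2  2  0  5  4  0 11  0 ∷
  box  2  2  0  4  6  0  0 17 ∷
  box  4  2  0  3  0  9  5  0 ∷
  box  2  2  0  6  0  4  0  9 ∷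
  box  2  2  0  0  4 10 10  0 ∷
  box  2  2  0  0  7  4  0 10 ∷
  box  2  2  0  0  9  0 10  5 ∷
  box  2  2  0  0  0  9 18  4 ∷
  box  2  0  3  3  9 12  0  0 ∷
  box  2  0  3  6  9  0  4  0 ∷
  box  2  0  3  4  7  0  0 17 ∷
  box  3  0  4  3  0  9  6  0 ∷
  box  2  0  3  4  0  9  0 19 ∷
  box  4  0  4  3  0  0  8  9 ∷
  box  2  0  3  0  4  3 10  0 ∷
  box  2  0  3  0  9  3  0  5 ∷
  box  2  0  3  0  6  0  4  5 ∷
  box  2  0  3  0  0  9 18  5 ∷
  box  2  0  0  4  6  9  0 15 ∷
  box  2  0  0  4  7  0 18 15 ∷
  box  2  0  0  6  0  9 18  9 ∷
  box  2  0  0  0  7  9 18 22 ∷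
  box  0  2  4  3  3  7  0  0 ∷
  box  0  2  3  4  9  0 13  0 ∷
  box  0  2  4  3  0  9  9  0 ∷
  box  0  2  3  6  0  9  0 17 ∷
  box  0  2  4  3  0  0  8 20 ∷
  box  0  2  3  0  4  7 10  0 ∷
  box  0  2  4  0  5  9  0 15 ∷
  box  0  2  4  0  0  9  8 16 ∷
  box  0  2  0  3  9  9 13  0 ∷
  box  0  2  0  3  5  9  0  6 ∷
  box  0  2  0  3  5  0 13 17 ∷
  box  0  2  0  3  0  9  8 22 ∷
  box  0  2  0  0  5  9 13  8 ∷
  box  0  0  4  3  3  9 13  0 ∷
  box  0  0  3  3  9  3  0  3 ∷
  box  0  0  4  3  5  0 13 18 ∷
  box  0  0  4  3  0  9  8 10 ∷
  box  0  0  3  0  6  9  4  4 ∷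
  box  0  0  0  3  5  9 13 16 ∷
  box  2  2  4  5  6  5  0  0 ∷
  box  2  2  3  5  4  0  7  0 ∷
  box  2  2  3  4  9  0  0 19 ∷
  box  4  2  4  3  0  9  6  0 ∷
  box  2  2  3  4  0  4  0  9 ∷
  box  2  2  3  6  0  0  6 10 ∷
  box  2  2  3  0  7  4  0  6 ∷
  box  2  2  3  0  0  9  4 13 ∷
  box  2  2  0  3  9  3  0 15 ∷
  box  2  2  0  4  9  0 17  5 ∷
  box  3  2  0  0  5  9 13 22 ∷
  box  2  0  3  4  7  9  4  0 ∷
  box  2  0  3  4  6  9  0 22 ∷
  box  3  0  4  3  0  9  8  5 ∷
  box  2  0  3  0  6  9  4 10 ∷
  box  4  0  0  3  5  9 13 22 ∷
  box  0  2  3  4  6  4  0 15 ∷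
  box  0  2  4  3  5  0 13  7 ∷
  box  0  2  4  3  0  9  8  6 ∷
  box  0  2  4  0  5  9 13 14 ∷
  box  0  2  0  3  5  9 13  3 ∷
  box  0  0  4  3  5  9 13  9 ∷
  box  2  2  3  6  7  9  4  0 ∷
  box  2  2  3  6  6  9  0 22 ∷
  box  2  2  3  4  9  0 17 10 ∷
  box  3  2  4  3  0  9  8  9 ∷
  box  2  2  3  0  6  9  4 16 ∷
  box  3  0  4  3  5  9 13  5 ∷
  box  0  2  4  3  5  9 13 19 ∷
  box  4  2  4  3  5  9 13  5 ∷
  []

-- The search evaluates to `true` during type checking.
table-covers : T (covers bounds table)
table-covers = tt

-- This encodes that each support has at most one box: a different row with an earlier row's support
-- would be shadowed by it.
table-lookup : All (λ row → lookupRow table (support row) ≡ row) table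
table-lookup = from-yes (ListAll.all? (λ row → ≡-dec _≟_ (lookupRow table (support row)) row) table)

-- Dropping the coordinate of `p` rules out the empty support and that of `p` alone in one test.
table-nontrivial : All (λ row → tail (support row) ≢ replicate 7 false) table
table-nontrivial = from-yes (ListAll.all? (λ row → ¬? (≡-dec Bool._≟_ (tail (support row)) (replicate 7 false))) table)

^-mono-∣ : ∀ q → m ≤ n → q ^ m ∣ q ^ n
^-mono-∣ {m} {n} q m≤n = divides (q ^ (n ∸ m)) (begin
  q ^ n                   ≡⟨ cong (q ^_) (sym (m∸n+n≡m m≤n)) ⟩
  q ^ (n ∸ m + m)         ≡⟨ ^-distribˡ-+-* q (n ∸ m) m ⟩
  q ^ (n ∸ m) * q ^ m     ∎)
  where open ≡-Reasoning

digits-positive : ∀ {x d} {qs ss es : Vec ℕ n} → Digits x d qs ss es → VecAll.All (0 <_) ss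
digits-positive []                     = []
digits-positive (digit 0<s _ _ _ ∷ Ds) = 0<s ∷ digits-positive Ds

lookupRow-∈ : ∀ {row} → row ∈ table → lookupRow table (support row) ≡ row
lookupRow-∈ = ListAll.lookup table-lookup

-- The covering system for given auxiliary primes.

module Covering
  (r p : ℕ) (qs : Vec ℕ 7)
  (>1 : VecAll.All (1 <_) (r ∷ p ∷ qs))
  (cop : AllPairs Coprime (r ∷ p ∷ qs))
  (odd : VecAll.All (Coprime 2) (r ∷ p ∷ qs))
  -- Nonzero digits go up to `q - 1`. An inequality lets a smaller prime take a slot of the table.
  (qs≤ : Pointwise (λ q b → q ≤ suc b) qs (tail bounds))
  (6≤p : 6 ≤ p)
  where

  qs⁺ : Vec ℕ 9
  qs⁺ = r ∷ p ∷ qs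

  r≢0 : NonZero r
  r≢0 = >-nonZero (<⇒≤ (VecAll.head >1))

  p≢0 : NonZero p
  p≢0 = >-nonZero (<⇒≤ (VecAll.head (VecAll.tail >1)))

  qs≢0 : VecAll.All NonZero qs
  qs≢0 = VecAll.map (>-nonZero ∘ <⇒≤) (VecAll.tail (VecAll.tail >1))

  -- Every exponent vector other than a power of p serves as a modulus; those with no factor r follow the table,
  -- while r q^e (1 ≤ e ≤ r) sweeps the residues e − 1 modulo r inside the class 0 modulo q^r.
  residues : Vec ℕ 9 → Vec ℕ 9
  residues (zero  ∷ es) = 0 ∷ digitResidues (p ∷ qs) (lookupRow table (support es)) es
  residues (suc _ ∷ es) = sum es ∸ 1 ∷ replicate 8 0

  congruence : Vec ℕ 9 → Congruence
  congruence es = proj₁ (crt-prodPow >1 cop es (residues es)) , prodPow qs⁺ es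

  -- The exponent of `p` is skipped, so exactly the powers of `p` are excluded, among them `1`, `p`
  -- and `p * p`.
  Nontrivial : Vec ℕ 9 → Set
  Nontrivial (ρ ∷ π ∷ es) = ρ ∷ es ≢ replicate 8 0

  nontrivial? : ∀ es → Dec (Nontrivial es)
  nontrivial? (ρ ∷ π ∷ es) = ¬? (≡-dec _≟_ (ρ ∷ es) (replicate 8 0))

  -- The bound `r` is both the number of levels at each prime and the number of moduli `r q^e` that
  -- fill the classes modulo `r`.
  exponents : List (Vec ℕ 9)
  exponents = filter nontrivial? (boundedVecs 9 r)

  -- There are `1 + (p - 6) = p - 5` of them.
  singleResidues : List ℕ
  singleResidues = 0 ∷ applyUpTo (λ i → 6 + i) (p ∸ 6)

  singles : List Congruence
  singles = List.map (_, p) singleResidues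

  composites : List Congruence
  composites = List.map congruence exponents

  system : List Congruence
  system = singles ++ composites

  Covered : ℤ → Set
  Covered x = Any (Satisfies x) system

  covered-single : ∀ {x a} → a ∈ singleResidues → x ≈ + a mod p → Covered x
  covered-single a∈ (congruent h) = lose (∈-++⁺ˡ (∈-map⁺ (_, p) a∈)) (ℤ∣.∣⇒∣ᵤ h)

  covered-composite : ∀ {x} es → VecAll.All (_≤ r) es → Nontrivial es → Solves x qs⁺ es (residues es) → Covered x
  covered-composite es es≤r es≢ solves =
    lose (∈-++⁺ʳ singles (∈-map⁺ congruence (∈-filter⁺ nontrivial? (∈-boundedVecs es≤r) es≢)))
         (ℤ∣.∣⇒∣ᵤ (divides-difference (proj₂ (proj₂ (crt-prodPow >1 cop es (residues es))) solves)))

  -- With `j` the residue of `x` modulo `r`, the modulus `r q^(j + 1)` catches `x`: its class is `j`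
  -- modulo `r` and 0 modulo `q^(j + 1)`, and `j + 1 ≤ r`.
  covered-tail : ∀ {x} i → x ≈ + 0 mod (lookup qs i ^ r) → Covered x
  covered-tail {x} i h =
    covered-composite (1 ∷ 0 ∷ unit i (suc j)) (<⇒≤ (VecAll.head >1) ∷ z≤n ∷ unit-bounded i j<r) (λ ())
      (subst (λ a → x ≈ + a mod (r ^ 1)) (sym (cong (_∸ 1) (sum-unit i (suc j))))
         (subst (λ m → x ≈ + j mod m) (sym (*-identityʳ r)) (≈-% x r {{r≢0}}))
       ∷ ≈-mod-1 _ _ ∷ solves-unit qs i (≈-weaken (^-mono-∣ (lookup qs i) j<r) h))
    where
    j = _%ℕ_ x r {{r≢0}}
    j<r : j < r
    j<r = n%ℕd<d x r {{r≢0}}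

  -- A box through the digits of `x`, combined with the levels of `x`, determines the modulus. As
  -- `residues` sees only the exponent vector, the box is found again through its support.
  covered-digits : ∀ {x ss es} → Digits x r (p ∷ qs) ss es → Pointwise _≤_ ss bounds → Covered x
  covered-digits {x} {ss} {es} Ds ss≤
    with row , row∈ , m ← covers-sound {bs = bounds} {table} table-covers (digits-positive Ds) ss≤ =
    covered-composite (0 ∷ fs) (z≤n ∷ truncate-bounded Ds m) nontrivial
      (≈-mod-1 _ _ ∷ subst (λ ts → Solves x (p ∷ qs) fs (digitResidues (p ∷ qs) ts fs)) row≡ (solves-truncate Ds m))
    where
    fs = truncate row es
    support≡ : support fs ≡ support row
    support≡ = support-truncate Ds m
    row≡ : row ≡ lookupRow table (support fs)
    row≡ = trans (sym (lookupRow-∈ row∈)) (cong (lookupRow table) (sym support≡))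
    nontrivial : Nontrivial (0 ∷ fs)
    nontrivial = lemma fs refl
      where
      -- Generalising `fs` to a variable exposes its first entry, which `Nontrivial` must match on.
      lemma : ∀ gs → gs ≡ fs → Nontrivial (0 ∷ gs)
      lemma (g ∷ gs) eq eq₀ = ListAll.lookup table-nontrivial row∈
        (trans (cong tail (trans (sym support≡) (cong support (sym eq)))) (cong support (∷-injectiveʳ eq₀)))

  covered : ∀ x → Covered x
  covered x with ≈-% x p {{p≢0}} | n%ℕd<d x p {{p≢0}}
  ... | x≈a | a<p with _%ℕ_ x p {{p≢0}}
  ...   | zero = covered-single (here refl) x≈a
  ...   | suc a with suc a ≤? 5
  ...     | no a≰5 = covered-single (there (subst (_∈ applyUpTo (λ i → 6 + i) (p ∸ 6)) (m+[n∸m]≡n (≰⇒> a≰5))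
                       (∈-applyUpTo⁺ (λ i → 6 + i) (∸-monoˡ-< a<p (≰⇒> a≰5))))) x≈a
  ...     | yes a≤5 with lastDigits x r qs≢0
  ...       | inj₁ (i , h) = covered-tail i h
  ...       | inj₂ (ss , es , ss<qs , Ds) =
    -- At `p` the level is always 1: the digit is the nonzero residue modulo `p` itself, here at
    -- most 5.
    covered-digits (digit {e = 1} (s≤s z≤n) (s≤s z≤n) (<⇒≤ (VecAll.head >1))
                     (subst₂ (λ b m → x ≈ + b mod m) (sym (*-identityʳ (suc a))) (sym (*-identityʳ p)) x≈a) ∷ Ds)
                   (a≤5 ∷ Pointwise.trans (λ s<q q≤ → s≤s⁻¹ (≤-trans s<q q≤)) ss<qs qs≤)

  -- Distinctness, parity and size of the moduli.

  congruence-injective : ∀ {es fs} → modulus (congruence es) ≡ modulus (congruence fs) → es ≡ fs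
  congruence-injective = prodPow-injective >1 cop

  exponents-unique : Unique exponents
  exponents-unique = Unique.filter⁺ nontrivial? (boundedVecs-unique 9 r)

  moduli-composites-unique : Unique (moduli composites)
  moduli-composites-unique = subst Unique (map-∘ exponents) (Unique.map⁺ congruence-injective exponents-unique)

  singleResidues<p : All (_< p) singleResidues
  singleResidues<p = ≤-trans (s≤s z≤n) 6≤p ∷
    ListAll.applyUpTo⁺₁ _ (p ∸ 6) λ i< → subst (_ <_) (m+[n∸m]≡n 6≤p) (+-monoʳ-< 6 i<)

  singleResidues-unique : Unique singleResidues
  singleResidues-unique =
    ListAll.applyUpTo⁺₂ _ (p ∸ 6) (λ _ ()) ∷
    Unique.applyUpTo⁺₁ _ (p ∸ 6) (λ i<j _ → <⇒≢ (+-monoʳ-< 6 i<j))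

  all-singles : ∀ {P : Congruence → Set} → (∀ {a} → a < p → P (a , p)) → All P singles
  all-singles h = ListAll.map⁺ (ListAll.map h singleResidues<p)

  all-composites : ∀ {P : Congruence → Set} → (∀ es → Nontrivial es → P (congruence es)) → All P composites
  all-composites h = ListAll.map⁺ (ListAll.map (h _) (ListAll.all-filter nontrivial? (boundedVecs 9 r)))

  p^-exponents : ∀ i → prodPow qs⁺ (0 ∷ i ∷ replicate 7 0) ≡ p ^ i
  p^-exponents i = begin
    1 * (p ^ i * prodPow qs (replicate 7 0))   ≡⟨ *-identityˡ _ ⟩
    p ^ i * prodPow qs (replicate 7 0)         ≡⟨ cong (p ^ i *_) (prodPow-zeros qs) ⟩
    p ^ i * 1                                  ≡⟨ *-identityʳ _ ⟩
    p ^ i                                      ∎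
    where open ≡-Reasoning

  -- By unique factorisation the exponent vector would be that of `p ^ i`, which `Nontrivial`
  -- forbids. The cases `i = 1, 0, 2` serve the count, the bound `1 < m` and the exclusion of
  -- `p * p`.
  modulus≢p^ : ∀ i es → Nontrivial es → modulus (congruence es) ≢ p ^ i
  modulus≢p^ i es es≢ eq
    with refl ← prodPow-injective >1 cop {es} {0 ∷ i ∷ replicate 7 0} (trans eq (sym (p^-exponents i)))
    = es≢ refl

  modulus≢p : ∀ es → Nontrivial es → modulus (congruence es) ≢ p
  modulus≢p es es≢ eq = modulus≢p^ 1 es es≢ (trans eq (sym (*-identityʳ p)))

  1<modulus : ∀ es → Nontrivial es → 1 < modulus (congruence es)
  1<modulus es es≢ =
    ≤∧≢⇒< (>-nonZero⁻¹ _ {{prodPow≢0 >1 es}}) (modulus≢p^ 0 es es≢ ∘ sym)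

  odd-modulus : ∀ es → 2 ∤ modulus (congruence es)
  odd-modulus es 2∣m = contradiction (coprime-prodPow odd es (∣-refl , 2∣m)) λ ()

  2∤p : 2 ∤ p
  2∤p 2∣p = contradiction (VecAll.head (VecAll.tail odd) (∣-refl , 2∣p)) λ ()

  system-unique : Unique system
  system-unique = Unique.++⁺
    (Unique.map⁺ (cong residue) singleResidues-unique)
    (Unique.map⁻ moduli-composites-unique)
    λ (c∈singles , c∈composites) →
      ListAll.lookup (all-composites {λ c → modulus c ≢ p} modulus≢p) c∈composites
        (ListAll.lookup (all-singles {λ c → modulus c ≡ p} λ _ → refl) c∈singles)

  isCovering : IsCoveringSystem system
  isCovering = record
    { normalised = ListAll.++⁺ (all-singles λ a<p → a<p)
                     (all-composites λ es _ → proj₁ (proj₂ (crt-prodPow >1 cop es (residues es))))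
    ; distinct   = system-unique
    ; covers     = covered
    }

  odd>1 : All (λ c → 2 ∤ modulus c × 1 < modulus c) system
  odd>1 = ListAll.++⁺ (all-singles λ _ → 2∤p , VecAll.head (VecAll.tail >1))
                      (all-composites λ es es≢ → odd-modulus es , 1<modulus es es≢)

  count≡ : countModulus p system ≡ p ∸ 5
  count≡ = begin
    length (filterᵇ isP system)
      ≡⟨ cong length (filter-++ (T? ∘ isP) singles composites) ⟩
    length (filterᵇ isP singles ++ filterᵇ isP composites)
      ≡⟨ cong₂ (λ cs ds → length (cs ++ ds))
           (filter-all (T? ∘ isP) (all-singles λ _ → ≡⇒≡ᵇ p p refl))
           (filter-none (T? ∘ isP) (all-composites λ es es≢ → modulus≢p es es≢ ∘ ≡ᵇ⇒≡ _ p)) ⟩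
    length (singles ++ [])
      ≡⟨ cong length (++-identityʳ singles) ⟩
    length singles
      ≡⟨ length-map (_, p) singleResidues ⟩
    suc (length (applyUpTo (λ i → 6 + i) (p ∸ 6)))
      ≡⟨ cong suc (length-applyUpTo (λ i → 6 + i) (p ∸ 6)) ⟩
    suc (p ∸ 6)
      ≡⟨ sym (+-∸-assoc 1 6≤p) ⟩
    p ∸ 5 ∎
    where
    open ≡-Reasoning
    isP : Congruence → Bool
    isP c = modulus c ≡ᵇ p

  -- The filter removes every single, leaving a sublist of the composite moduli, which are already
  -- distinct.
  otherModuli-unique : Unique (otherModuli p system)
  otherModuli-unique = subst Unique (sym filtered) (Unique.filter⁺ (T? ∘ notP) moduli-composites-unique)
    where
    notP : ℕ → Bool
    notP k = not (k ≡ᵇ p)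
    filtered : otherModuli p system ≡ filterᵇ notP (moduli composites)
    filtered = begin
      filterᵇ notP (moduli system)
        ≡⟨ cong (filterᵇ notP) (map-++ modulus singles composites) ⟩
      filterᵇ notP (moduli singles ++ moduli composites)
        ≡⟨ filter-++ (T? ∘ notP) (moduli singles) (moduli composites) ⟩
      filterᵇ notP (moduli singles) ++ filterᵇ notP (moduli composites)
        ≡⟨ cong (_++ filterᵇ notP (moduli composites))
             (filter-none (T? ∘ notP) (ListAll.map⁺ {f = modulus} (all-singles λ _ → p-excluded))) ⟩
      filterᵇ notP (moduli composites) ∎
      where
      open ≡-Reasoning
      p-excluded : ¬ T (notP p)
      p-excluded h with p ≡ᵇ p | ≡⇒≡ᵇ p p refl
      ... | true | _ = h

  no-p² : All (λ c → modulus c ≢ p * p) system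
  no-p² = ListAll.++⁺
    (all-singles λ _ p≡p*p → <⇒≢ (m<m*n p p {{p≢0}} (VecAll.head (VecAll.tail >1))) p≡p*p)
    (all-composites λ es es≢ eq → modulus≢p^ 2 es es≢ (trans eq (cong (p *_) (sym (*-identityʳ p)))))

-- Choice of the auxiliary primes and conclusion.

distinctPrimes⇒coprime : ∀ {p q} → Prime p → Prime q → p ≢ q → Coprime p q
distinctPrimes⇒coprime p-prime q-prime p≢q (d∣p , d∣q)
  with prime⇒irreducible p-prime d∣p | prime⇒irreducible q-prime d∣q
... | inj₁ d≡1 | _        = d≡1
... | inj₂ _   | inj₁ d≡1 = d≡1
... | inj₂ d≡p | inj₂ d≡q = contradiction (trans (sym d≡p) d≡q) p≢q

Admissible : (r : ℕ) (qs : Vec ℕ 7) → Set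
Admissible r qs =
  VecAll.All Prime (r ∷ qs) × VecAll.All (Coprime 2) (r ∷ qs) × AllPairs Coprime (r ∷ qs) ×
  Pointwise (λ q b → q ≤ suc b) qs (tail bounds)

admissible? : ∀ r qs → Dec (Admissible r qs)
admissible? r qs =
  VecAll.all? prime? (r ∷ qs) ×-dec VecAll.all? (coprime? 2) (r ∷ qs) ×-dec allPairs? coprime? (r ∷ qs) ×-dec
  Pointwise.decidable (λ q b → q ≤? suc b) qs (tail bounds)

avoids? : ∀ p r (qs : Vec ℕ 7) → Dec (VecAll.All (p ≢_) (r ∷ qs))
avoids? p r qs = VecAll.all? (λ q → ¬? (p ≟ q)) (r ∷ qs)

-- Since `17 ≤ p`, only 19, 23 and 29 can collide with `p`. The prime 17 is kept in reserve: it fits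
-- the slots of 19 and 23, being smaller, and it can also serve as `r`. The case `p = 17` falls
-- under the last clause.
auxiliaryPrimes : ∀ p → 17 ≤ p → ∃₂ λ r qs → Admissible r qs × VecAll.All (p ≢_) (r ∷ qs)
auxiliaryPrimes p 17≤p with p ≟ 19 | p ≟ 23 | p ≟ 29
... | yes refl | _ | _ =
  let qs = 3 ∷ 5 ∷ 7 ∷ 11 ∷ 13 ∷ 17 ∷ 23 ∷ [] in
  29 , qs , from-yes (admissible? 29 qs) , from-yes (avoids? 19 29 qs)
... | _ | yes refl | _ =
  let qs = 3 ∷ 5 ∷ 7 ∷ 11 ∷ 13 ∷ 19 ∷ 17 ∷ [] in
  29 , qs , from-yes (admissible? 29 qs) , from-yes (avoids? 23 29 qs)
... | _ | _ | yes refl =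
  let qs = 3 ∷ 5 ∷ 7 ∷ 11 ∷ 13 ∷ 19 ∷ 23 ∷ [] in
  17 , qs , from-yes (admissible? 17 qs) , from-yes (avoids? 29 17 qs)
... | no p≢19 | no p≢23 | no p≢29 =
  let qs = 3 ∷ 5 ∷ 7 ∷ 11 ∷ 13 ∷ 19 ∷ 23 ∷ [] in
  29 , qs , from-yes (admissible? 29 qs) ,
  p≢29 ∷ ≢small 3 ∷ ≢small 5 ∷ ≢small 7 ∷ ≢small 11 ∷ ≢small 13 ∷ p≢19 ∷ p≢23 ∷ []
  where
  ≢small : ∀ q → {True (q <? 17)} → p ≢ q
  ≢small q {q<17} p≡q = <⇒≱ (toWitness q<17) (subst (17 ≤_) p≡q 17≤p)

theorem2p4 : (p : ℕ) → Prime p → 17 ≤ p →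
    Σ (List Congruence) λ cs →
    IsCoveringSystem cs
    × All (λ c → 2 ∤ modulus c × 1 < modulus c) cs
    × countModulus p cs ≡ p ∸ 5
    × Unique (otherModuli p cs)
    × All (λ c → modulus c ≢ p * p) cs
theorem2p4 p p-prime 17≤p
  with r , qs , (r-prime ∷ qs-prime , r-odd ∷ qs-odd , r-qs ∷ qs-cop , qs≤) , p≢r ∷ p≢qs ← auxiliaryPrimes p 17≤p
  = system , isCovering , odd>1 , count≡ , otherModuli-unique , no-p²
  where
  2≢p : 2 ≢ p
  2≢p = <⇒≢ (≤-trans (from-yes (3 ≤? 17)) 17≤p)
  open Covering r p qs
    (VecAll.map (λ q-prime → nonTrivial⇒n>1 _ {{prime⇒nonTrivial q-prime}}) (r-prime ∷ p-prime ∷ qs-prime))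
    ((distinctPrimes⇒coprime r-prime p-prime (p≢r ∘ sym) ∷ r-qs)
      ∷ VecAll.map (λ (q-prime , p≢q) → distinctPrimes⇒coprime p-prime q-prime p≢q) (VecAll.zip (qs-prime , p≢qs))
      ∷ qs-cop)
    (r-odd ∷ distinctPrimes⇒coprime prime[2] p-prime 2≢p ∷ qs-odd)
    qs≤
    (≤-trans (from-yes (6 ≤? 17)) 17≤p)
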